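{- Let $\succ$ be a well-founded, one-step generated, and effectively finitely branching weakening relation, and assume that the consequence relation $\models$ is decidable. Then, given an ontology $\mathfrak{O}=\mathfrak{O}_s\cup\mathfrak{O}_r$, a justification $J$ for a consequence $\alpha$, and an axiom $\beta\in J$, the set of all maximally strong weakenings of $\beta$ in $J$ is finite and can effectively be computed.
   Context: Fix a logic with a model-theoretic semantics (ontologies are finite sets of axioms; $\mathfrak{O}\models\alpha$ iff every model of $\mathfrak{O}$ satisfies $\alpha$; $\mathit{Con}(\mathfrak{O})=\{\alpha\mid\mathfrak{O}\models\alpha\}$). An ontology is split $\mathfrak{O}=\mathfrak{O}_s\cup\mathfrak{O}_r$ (static, refutable); a justification for $\alpha$ is an inclusion-minimal $J\subseteq\mathfrak{O}_r$ with $\mathfrak{O}_s\cup J\models\alpha$. A pre-order (irreflexive, transitive) $\succ$ on axioms is a weakening relation if $\beta\succ\gamma$ implies $\mathit{Con}(\{\gamma\})\subsetneq\mathit{Con}(\{\beta\})$; well-founded if there is no infinite chain $\beta_1\succ\beta_2\succ\cdots$. Its one-step relation is $\succ_1=\{(\beta,\gamma)\in\succ\mid$ no $\delta$ with $\beta\succ\delta\succ\gamma\}$; $\succ$ is one-step generated if $\succ_1^+=\succ$; a one-step generated $\succ$ is effectively finitely branching if for every axiom $\beta$ the set $\{\gamma\mid\beta\succ_1\gamma\}$ is finite and can effectively be computed. An axiom $\gamma$ with $\beta\succ\gamma$ is a maximally strong weakening of $\beta$ in $J$ if $\mathfrak{O}_s\cup(J\setminus\{\beta\})\cup\{\gamma\}\not\models\alpha$,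 but $\mathfrak{O}_s\cup(J\setminus\{\beta\})\cup\{\delta\}\models\alpha$ for all $\delta$ with $\beta\succ\delta\succ\gamma$. -}

module Defs where

open import Level using (Level; _⊔_)
open import Data.List using (List; []; _∷_; _++_; [_]; filter)
open import Data.List.Membership.Propositional using (_∈_)
open import Data.List.Relation.Binary.Subset.Propositional using (_⊆_)
open import Data.Product using (Σ; ∃; _×_)
open import Relation.Nullary using (¬_; ¬?)
open import Relation.Binary.Core using (Rel)
open import Relation.Binary.Definitions using (DecidableEquality)
open import Relation.Binary.PropositionalEquality using (_≡_)
open import Relation.Binary.Construct.Closure.Transitive using (TransClosure)
open import Function.Bundles using (_⇔_)

private
  variable
    a m ℓ r : Level

-- Ontologies are finite sets of axioms, represented
-- by lists (read as sets: only membership matters).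

Entails : {Ax : Set a} {Mod : Set m} (_⊩_ : Mod → Ax → Set ℓ) →
          List Ax → Ax → Set (a ⊔ m ⊔ ℓ)
Entails _⊩_ O α = ∀ M → (∀ x → x ∈ O → M ⊩ x) → M ⊩ α

ConStrictSub : {Ax : Set a} {Mod : Set m} (_⊩_ : Mod → Ax → Set ℓ) →
               Ax → Ax → Set (a ⊔ m ⊔ ℓ)
ConStrictSub _⊩_ γ β =
  (∀ δ → Entails _⊩_ [ γ ] δ → Entails _⊩_ [ β ] δ) ×
  (∃ λ δ → Entails _⊩_ [ β ] δ × ¬ Entails _⊩_ [ γ ] δ)

record IsWeakeningRelation {Ax : Set a} {Mod : Set m} (_⊩_ : Mod → Ax → Set ℓ)
                           (_≻_ : Rel Ax r) : Set (a ⊔ m ⊔ ℓ ⊔ r) where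
  field
    irrefl   : ∀ β → ¬ (β ≻ β)
    trans    : ∀ {β γ δ} → β ≻ γ → γ ≻ δ → β ≻ δ
    weakens  : ∀ {β γ} → β ≻ γ → ConStrictSub _⊩_ γ β

OneStep : {Ax : Set a} → Rel Ax r → Rel Ax (a ⊔ r)
OneStep _≻_ β γ = (β ≻ γ) × ¬ (∃ λ δ → (β ≻ δ) × (δ ≻ γ))

OneStepGenerated : {Ax : Set a} → Rel Ax r → Set (a ⊔ r)
OneStepGenerated _≻_ = ∀ β γ → (β ≻ γ) ⇔ TransClosure (OneStep _≻_) β γ

EffectivelyFinitelyBranching : {Ax : Set a} → Rel Ax r → Set (a ⊔ r)
EffectivelyFinitelyBranching {Ax = Ax} _≻_ =
  Σ (Ax → List Ax) λ succs → ∀ β γ → (γ ∈ succs β) ⇔ OneStep _≻_ β γ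

remove : {Ax : Set a} → DecidableEquality Ax → List Ax → Ax → List Ax
remove _≟_ J β = filter (λ x → ¬? (x ≟ β)) J

IsJustification : {Ax : Set a} {Mod : Set m} (_⊩_ : Mod → Ax → Set ℓ) →
                  (Os Or J : List Ax) → Ax → Set (a ⊔ m ⊔ ℓ)
IsJustification _⊩_ Os Or J α =
  (J ⊆ Or) × Entails _⊩_ (Os ++ J) α ×
  (∀ J' → J' ⊆ J → Entails _⊩_ (Os ++ J') α → J ⊆ J')

IsMaxStrongWeakening : {Ax : Set a} {Mod : Set m} (_⊩_ : Mod → Ax → Set ℓ) →
                       DecidableEquality Ax → Rel Ax r →
                       (Os J : List Ax) (α β γ : Ax) → Set (a ⊔ m ⊔ ℓ ⊔ r)
IsMaxStrongWeakening _⊩_ _≟_ _≻_ Os J α β γ =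
  (β ≻ γ) ×
  ¬ Entails _⊩_ (Os ++ remove _≟_ J β ++ [ γ ]) α ×
  (∀ δ → β ≻ δ → δ ≻ γ → Entails _⊩_ (Os ++ remove _≟_ J β ++ [ δ ]) α)

module Submission where

open import Defs
open import Level using (Level)
open import Data.List using (List; _∷_; _++_; [_]; concat; filter)
open import Data.List.Membership.Propositional using (_∈_; mapWith∈)
open import Data.List.Membership.Propositional.Properties using (∈-concat⁺; ∈-concat⁻; ∈-filter⁺; ∈-filter⁻)
import Data.List.Membership.DecPropositional as DecMembership
open import Data.List.Relation.Unary.Any using (here; there)
open import Data.List.Relation.Unary.Any.Properties using (mapWith∈⁺; mapWith∈⁻)
open import Data.List.Relation.Unary.All as All using (all?)
open import Data.Product using (Σ; _,_; proj₁; proj₂)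
open import Relation.Nullary using (Dec; ¬?)
open import Relation.Nullary.Decidable using (_×-dec_; _→-dec_)
import Relation.Nullary.Decidable as Dec
open import Relation.Unary using (Pred; Decidable)
open import Relation.Binary.Core using (Rel)
open import Relation.Binary.Definitions using (DecidableEquality)
open import Relation.Binary.PropositionalEquality using (refl)
open import Relation.Binary.Construct.Closure.Transitive using (TransClosure) renaming ([_] to [_]⁺; _∷_ to _∷⁺_)
open import Induction.WellFounded using (WellFounded; Acc; acc; module Subrelation)
open import Function.Base using (flip)
open import Function.Bundles using (_⇔_; mk⇔; Equivalence)
open import Function.Properties.Equivalence using () renaming (sym to ⇔-sym; trans to ⇔-trans)

-- Every weakening of β is reached from β by finitely many one-step weakenings;
-- as there are finitely many one-step weakenings of each axiom and no infinite
-- descending chains, recursion on accessibility enumerates all weakenings of β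
-- (König's lemma in constructive form).  The maximally strong weakenings are
-- then filtered out by a decidable test, whose quantifier over the axioms δ with
-- β ≻ δ ≻ γ ranges over this finite list.

∈-filter⇔ : ∀ {a p} {A : Set a} {P : Pred A p} (P? : Decidable P) {xs : List A} →
            (∀ {x} → P x → x ∈ xs) → ∀ x → x ∈ filter P? xs ⇔ P x
∈-filter⇔ P? {xs} P⊆xs x = mk⇔ (λ x∈ → proj₂ (∈-filter⁻ P? {xs = xs} x∈))
                               (λ Px → ∈-filter⁺ P? (P⊆xs Px) Px)

∀-enumerated? : ∀ {a s q} {A : Set a} {S : Pred A s} {Q : Pred A q} (xs : List A) →
                (∀ x → x ∈ xs ⇔ S x) → Decidable Q → Dec (∀ x → S x → Q x)
∀-enumerated? xs xs⇔S Q? =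
  Dec.map′ (λ all x Sx → All.lookup all (Equivalence.from (xs⇔S x) Sx))
           (λ ∀Q → All.tabulate λ {x} x∈ → ∀Q x (Equivalence.to (xs⇔S x) x∈))
           (all? Q? xs)

module FinitelyBranching {a r : Level} {A : Set a} {_R_ : Rel A r}
  (successors : A → List A)
  (∈-successors⇔ : ∀ x y → y ∈ successors x ⇔ x R y) where

  private
    successor : ∀ {x y} → y ∈ successors x → x R y
    successor {x} {y} = Equivalence.to (∈-successors⇔ x y)

    successor⁻ : ∀ {x y} → x R y → y ∈ successors x
    successor⁻ {x} {y} = Equivalence.from (∈-successors⇔ x y)

  reachable : ∀ x → Acc (flip _R_) x → List A
  reachableVia : ∀ {x} → (∀ {y} → x R y → Acc (flip _R_) y) →
                 ∀ {y} → y ∈ successors x → List A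

  reachable x (acc rs) = concat (mapWith∈ (successors x) (reachableVia rs))
  reachableVia rs {y} y∈ = y ∷ reachable y (rs (successor y∈))

  ∈-reachable⁻ : ∀ {x z} (acc-x : Acc (flip _R_) x) →
                 z ∈ reachable x acc-x → TransClosure _R_ x z
  ∈-reachable⁻ {x} (acc rs) z∈ with mapWith∈⁻ (successors x) _ (∈-concat⁻ _ z∈)
  ... | y , y∈ , here refl = [ successor y∈ ]⁺
  ... | y , y∈ , there z∈′ = successor y∈ ∷⁺ ∈-reachable⁻ (rs (successor y∈)) z∈′

  ∈-reachable⁺ : ∀ {x z} (acc-x : Acc (flip _R_) x) →
                 TransClosure _R_ x z → z ∈ reachable x acc-x
  ∈-reachable⁺ (acc rs) [ xRz ]⁺ =
    ∈-concat⁺ (mapWith∈⁺ (reachableVia rs) (_ , successor⁻ xRz , here refl))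
  ∈-reachable⁺ (acc rs) (xRy ∷⁺ yR⁺z) =
    ∈-concat⁺ (mapWith∈⁺ (reachableVia rs) (_ , y∈ , there (∈-reachable⁺ (rs (successor y∈)) yR⁺z)))
    where y∈ = successor⁻ xRy

  ∈-reachable⇔ : ∀ {x} (acc-x : Acc (flip _R_) x) z →
                 z ∈ reachable x acc-x ⇔ TransClosure _R_ x z
  ∈-reachable⇔ acc-x z = mk⇔ (∈-reachable⁻ acc-x) (∈-reachable⁺ acc-x)

module Weakenings {a r : Level} {A : Set a} {_≻_ : Rel A r}
  (≻-wellFounded : WellFounded (flip _≻_))
  (≻-oneStepGenerated : OneStepGenerated _≻_)
  (≻-effectivelyFinitelyBranching : EffectivelyFinitelyBranching _≻_) where

  open FinitelyBranching (proj₁ ≻-effectivelyFinitelyBranching)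
                         (proj₂ ≻-effectivelyFinitelyBranching)

  oneStep-wellFounded : WellFounded (flip (OneStep _≻_))
  oneStep-wellFounded = Subrelation.wellFounded proj₁ ≻-wellFounded

  weakenings : A → List A
  weakenings β = reachable β (oneStep-wellFounded β)

  ∈-weakenings⇔ : ∀ β γ → γ ∈ weakenings β ⇔ β ≻ γ
  ∈-weakenings⇔ β γ =
    ⇔-trans (∈-reachable⇔ (oneStep-wellFounded β) γ) (⇔-sym (≻-oneStepGenerated β γ))

  module DecidableWeakening (_≟_ : DecidableEquality A) where
    open DecMembership _≟_ using (_∈?_)

    _≻?_ : ∀ β γ → Dec (β ≻ γ)
    β ≻? γ = Dec.map (∈-weakenings⇔ β γ) (γ ∈? weakenings β)

proposition16 : {a m ℓ r : Level} {Ax : Set a} {Mod : Set m}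
    (_⊩_ : Mod → Ax → Set ℓ) (_≟_ : DecidableEquality Ax) (_≻_ : Rel Ax r) →
    IsWeakeningRelation _⊩_ _≻_ →
    WellFounded (flip _≻_) →
    OneStepGenerated _≻_ →
    EffectivelyFinitelyBranching _≻_ →
    ((O : List Ax) (α : Ax) → Dec (Entails _⊩_ O α)) →
    (Os Or J : List Ax) (α β : Ax) →
    IsJustification _⊩_ Os Or J α →
    β ∈ J →
    Σ (List Ax) (λ L → ∀ γ → (γ ∈ L) ⇔ IsMaxStrongWeakening _⊩_ _≟_ _≻_ Os J α β γ)
proposition16 {Ax = Ax} _⊩_ _≟_ _≻_ _ wf osg efb entails? Os _ J α β _ _ =
  filter maxStrong? (weakenings β) ,
  ∈-filter⇔ maxStrong? (λ {γ} msw → Equivalence.from (∈-weakenings⇔ β γ) (proj₁ msw))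
  where
  open Weakenings wf osg efb
  open DecidableWeakening _≟_

  EntailedWith : Ax → Set _
  EntailedWith δ = Entails _⊩_ (Os ++ remove _≟_ J β ++ [ δ ]) α

  entailedWith? : Decidable EntailedWith
  entailedWith? δ = entails? (Os ++ remove _≟_ J β ++ [ δ ]) α

  maxStrong? : Decidable (IsMaxStrongWeakening _⊩_ _≟_ _≻_ Os J α β)
  maxStrong? γ =
    (β ≻? γ) ×-dec ¬? (entailedWith? γ) ×-dec
    ∀-enumerated? (weakenings β) (∈-weakenings⇔ β)
                  (λ δ → δ ≻? γ →-dec entailedWith? δ)
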